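{- Let $G$ be a finite simple graph, let $v$ be a leaf vertex of $G$ and let $uv$ be the corresponding leaf edge. For an integer $n\ge 2$, let $G_v^n$ be the clan graph of $G$ obtained by replacing $v$ by a complete graph $K_n$ with vertices $v_1,\ldots,v_n$. Then \[ Y_{G_v^n} = Y_{G-v} + (Y_{K_n}-1)\,Y_{G-\{u,v\}} + \sum_{\alpha}X_{G_v^n}^{\alpha}, \] where $\alpha$ ranges over all maps from $V(G_v^n)$ to $\mathbb{N}$ such that $\alpha(u)\ge 1$ and $\alpha(v_i)\ge 1$ for some $1\le i\le n$.
   Context: $\mathbb{N}=\{0,1,2,\ldots\}$. A leaf vertex is a vertex of degree $1$. The graph $G_v^n$ is obtained from $G$ by replacing $v$ by the complete graph $K_n$ on $v_1,\ldots,v_n$ while preserving adjacency: each $v_i$ is adjacent to every neighbor of $v$ in $G$ (that is, to $u$) and to all other $v_j$, and all other adjacencies are as in $G$. $G-v$ and $G-\{u,v\}$ denote the graphs obtained by deleting the indicated vertices. Let $\mathbf{x}=\{x_1,x_2,\ldots\}$ be indeterminates. For a finite simple graph $H$ and $\alpha:V(H)\to\mathbb{N}$, a multicoloring of $H$ of type $\alpha$ is a map $\kappa$ assigning to each vertex $w$ a finite set $\kappa(w)$ of positive integers with $|\kappa(w)|=\alpha(w)$; it is proper if $\kappa(w)\cap\kappa(w')=\emptyset$ for every edge $ww'$. Define $X_H^\alpha=\sum_\kappa x_1^{a_1}x_2^{a_2}\cdots$, summed over all proper multicolorings $\kappa$ of type $\alpha$, where $a_i$ is the number of vertices $w$ with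 $i\in\kappa(w)$. Define the formal power series $Y_H=\sum_{\alpha:V(H)\to\mathbb{N}}X_H^\alpha$ (for the graph with no vertices, $Y=1$). -}

module Defs where

open import Level using (0ℓ)
open import Data.Bool.Base using (Bool; true; false; T; if_then_else_)
import Data.Bool.Properties as Bool
open import Data.Empty using (⊥-elim)
open import Data.Fin.Base using (Fin; zero; suc; punchIn; punchOut; splitAt)
import Data.Fin.Properties as Fin
open import Data.Integer.Base as ℤ using (ℤ; 0ℤ; 1ℤ)
open import Data.List.Base as List using (List; []; _∷_; length)
import Data.List.Properties as List
open import Data.List.Membership.Propositional using (_∈_)
open import Data.List.Membership.Propositional.Properties
  using (∈-map⁺; ∈-filter⁻; ∈-deduplicate⁺; ∈-cartesianProductWith⁺)
open import Data.List.Relation.Unary.Any using (here; there)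
open import Data.List.Relation.Unary.Unique.Propositional using (Unique)
open import Data.List.Relation.Unary.Unique.DecPropositional.Properties using (deduplicate-!)
open import Data.Nat.Base as ℕ using (ℕ; zero; suc; pred; _≤_; _<_; _∸_; _⊔_; z≤n; s≤s)
import Data.Nat.Properties as ℕ
open import Data.Product using (_×_; _,_)
open import Data.Sum.Base using (_⊎_; inj₁; inj₂)
open import Data.Vec.Base as Vec using (Vec; []; _∷_; lookup)
import Data.Vec.Properties as Vec
open import Function.Base using (_∘_; id)
open import Relation.Binary.Core using (Rel)
open import Relation.Binary.Definitions
  using (Symmetric; DecidableEquality) renaming (Decidable to Decidable₂)
open import Relation.Binary.PropositionalEquality
  using (_≡_; _≢_; refl; sym; trans; cong; subst)
open import Relation.Nullary using (¬_; Dec; yes; no; does; ¬?; recompute; _×-dec_; _→-dec_)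
open import Relation.Nullary.Decidable using (map′; T?)
open import Relation.Unary using (Pred; Decidable)
open import Relation.Unary.Properties using (U?)

------------------------------------------------------------------------
-- Finitely supported sequences

-- A sequence (aᵢ) with aᵢ = z for almost all i, stored as its initial
-- segment up to the last entry different from z; _≡_ is then equality of
-- sequences.  Positions are counted from 0: position i stands for the
-- positive integer i + 1.
module FinSupp {A : Set} (z : A) (_≟_ : DecidableEquality A) where

  infixr 5 _◂_

  _◂_ : A → List A → List A
  x ◂ (y ∷ ys) = x ∷ y ∷ ys
  x ◂ []       = if does (x ≟ z) then [] else x ∷ []

  trim : List A → List A
  trim = List.foldr _◂_ []

  record Seq : Set where
    constructor mk
    field
      entries  : List A
      .trimmed : trim entries ≡ entries

  open Seq public

  at : List A → ℕ → A
  at []       _       = z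
  at (x ∷ xs) zero    = x
  at (x ∷ xs) (suc i) = at xs i

  infix 9 _‼_

  _‼_ : Seq → ℕ → A
  s ‼ i = at (entries s) i

  size : Seq → ℕ
  size s = length (entries s)

  trim-◂ : ∀ x xs → trim (x ◂ xs) ≡ x ◂ trim xs
  trim-◂ x (y ∷ ys) = refl
  trim-◂ x [] with x ≟ z
  ... | yes _ = refl
  ... | no x≢z with x ≟ z
  ...   | yes x≡z = ⊥-elim (x≢z x≡z)
  ...   | no  _   = refl

  trim-idem : ∀ xs → trim (trim xs) ≡ trim xs
  trim-idem []       = refl
  trim-idem (x ∷ xs) = trans (trim-◂ x (trim xs)) (cong (x ◂_) (trim-idem xs))

  fromList : List A → Seq
  fromList xs = mk (trim xs) (trim-idem xs)

  entries-injective : ∀ {s t} → entries s ≡ entries t → s ≡ t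
  entries-injective refl = refl

  infix 4 _≟ˢ_

  _≟ˢ_ : DecidableEquality Seq
  s ≟ˢ t = map′ entries-injective (cong entries) (List.≡-dec _≟_ (entries s) (entries t))

  fromList-entries : ∀ s → fromList (entries s) ≡ s
  fromList-entries (mk xs t) = entries-injective (recompute (List.≡-dec _≟_ _ _) t)

  at-◂ : ∀ x xs i → at (x ◂ xs) i ≡ at (x ∷ xs) i
  at-◂ x (y ∷ ys) i = refl
  at-◂ x [] i with x ≟ z
  at-◂ x [] zero    | yes x≡z = sym x≡z
  at-◂ x [] (suc i) | yes x≡z = refl
  ... | no _ = refl

  at-trim : ∀ xs i → at (trim xs) i ≡ at xs i
  at-trim []       i       = refl
  at-trim (x ∷ xs) zero    = at-◂ x (trim xs) zero
  at-trim (x ∷ xs) (suc i) = trans (at-◂ x (trim xs) (suc i)) (at-trim xs i)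

  at-applyUpTo : ∀ (f : ℕ → A) {n i} → i < n → at (List.applyUpTo f n) i ≡ f i
  at-applyUpTo f {suc n} {zero}  _         = refl
  at-applyUpTo f {suc n} {suc i} (s≤s i<n) = at-applyUpTo (f ∘ suc) i<n

  at≢z⇒< : ∀ xs {i} → at xs i ≢ z → i < length xs
  at≢z⇒< []       at≢z         = ⊥-elim (at≢z refl)
  at≢z⇒< (x ∷ xs) {zero}  _    = s≤s z≤n
  at≢z⇒< (x ∷ xs) {suc i} at≢z = s≤s (at≢z⇒< xs at≢z)

  trim-tail : ∀ x ys xs → x ◂ ys ≡ x ∷ xs → ys ≡ xs
  trim-tail x (y ∷ ys) .(y ∷ ys) refl = refl
  trim-tail x [] xs eq with x ≟ z
  trim-tail x [] .[] refl | no _ = refl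

  at-last : ∀ xs {k} → trim xs ≡ xs → length xs ≡ suc k → at xs k ≢ z
  at-last (x ∷ []) {zero} eq _ x≡z with x ≟ z
  at-last (x ∷ []) {zero} () _ x≡z | yes _
  ... | no x≢z = x≢z x≡z
  at-last (x ∷ y ∷ xs) {suc k} eq len =
    at-last (y ∷ xs) (trim-tail x _ _ eq) (ℕ.suc-injective len)

  last≢z : ∀ s {k} → size s ≡ suc k → s ‼ k ≢ z
  last≢z (mk xs t) = at-last xs (recompute (List.≡-dec _≟_ _ _) t)

------------------------------------------------------------------------
-- Monomials and finite sets of positive integers

module Mono = FinSupp {ℕ} 0 ℕ._≟_
module Sets = FinSupp {Bool} false Bool._≟_

-- m ‼ i is the exponent of xᵢ₊₁ in m.
Monomial : Set
Monomial = Mono.Seq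

-- A set of positive integers, given by its indicator sequence.
FinSet : Set
FinSet = Sets.Seq

infix 4 _∈ˢ_ _∈ˢ?_

_∈ˢ_ : ℕ → FinSet → Set
i ∈ˢ S = T (S Sets.‼ i)

_∈ˢ?_ : ∀ i S → Dec (i ∈ˢ S)
i ∈ˢ? S = T? (S Sets.‼ i)

card : FinSet → ℕ
card S = length (List.filter T? (Sets.entries S))

Disjoint : Rel FinSet 0ℓ
Disjoint S S′ = ∀ i → ¬ (i ∈ˢ S × i ∈ˢ S′)

T⇒≢false : ∀ {b} → T b → b ≢ false
T⇒≢false {true} _ ()

≢false⇒T : ∀ {b} → b ≢ false → T b
≢false⇒T {false} b≢ = b≢ refl
≢false⇒T {true}  _  = _

disjoint? : Decidable₂ Disjoint
disjoint? S S′ = map′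
  (λ h i (i∈S , i∈S′) → h (Sets.at≢z⇒< (Sets.entries S) (T⇒≢false i∈S)) (i∈S , i∈S′))
  (λ h {i} _ → h i)
  (ℕ.allUpTo? (λ i → ¬? ((i ∈ˢ? S) ×-dec (i ∈ˢ? S′))) (Sets.size S))

------------------------------------------------------------------------
-- Formal power series in x₁, x₂, … with integer coefficients

PowerSeries : Set
PowerSeries = Monomial → ℤ

infix  4 _≈_
infixl 6 _⊕_ _⊖_
infixl 7 _⊛_

_≈_ : Rel PowerSeries 0ℓ
f ≈ g = ∀ m → f m ≡ g m

_⊕_ _⊖_ : PowerSeries → PowerSeries → PowerSeries
(f ⊕ g) m = f m ℤ.+ g m
(f ⊖ g) m = f m ℤ.- g m

x^_ : Monomial → PowerSeries
(x^ a) m = if does (a Mono.≟ˢ m) then 1ℤ else 0ℤ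

𝟙 : PowerSeries
𝟙 = x^ Mono.fromList []

sumℤ : List ℤ → ℤ
sumℤ = List.foldr ℤ._+_ 0ℤ

splits : List ℕ → List (List ℕ × List ℕ)
splits []       = ([] , []) ∷ []
splits (e ∷ es) = List.cartesianProductWith
  (λ i (as , bs) → (i ∷ as , e ∸ i ∷ bs)) (List.upTo (suc e)) (splits es)

-- The pairs of monomials with product m, each listed once.
factorizations : Monomial → List (Monomial × Monomial)
factorizations m =
  List.map (λ (as , bs) → Mono.fromList as , Mono.fromList bs) (splits (Mono.entries m))

_⊛_ : PowerSeries → PowerSeries → PowerSeries
(f ⊛ g) m = sumℤ (List.map (λ (a , b) → f a ℤ.* g b) (factorizations m))

-- A family is summable when each monomial has a nonzero coefficient in
-- only finitely many members.  The list may contain further indices; they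
-- contribute 0, so the sum below does not depend on the choice of list.
record Summable {I : Set} (f : I → PowerSeries) : Set where
  field
    support  : Monomial → List I
    unique   : ∀ m → Unique (support m)
    complete : ∀ {m i} → f i m ≢ 0ℤ → i ∈ support m

-- The sum of f i over the indices i satisfying P.
∑ : {I : Set} (f : I → PowerSeries) → Summable f → {P : Pred I 0ℓ} → Decidable P → PowerSeries
∑ f S P? m = sumℤ (List.map (λ i → f i m) (List.filter P? (Summable.support S m)))

------------------------------------------------------------------------
-- Finite simple graphs

record Graph (N : ℕ) : Set₁ where
  field
    Adj    : Rel (Fin N) 0ℓ
    adj?   : Decidable₂ Adj
    symm   : Symmetric Adj
    irrefl : ∀ {x} → ¬ Adj x x

open Graph public

degree : ∀ {N} → Graph N → Fin N → ℕ
degree {N} G v = length (List.filter (adj? G v) (List.allFin N))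

Leaf : ∀ {N} → Graph N → Fin N → Set
Leaf G v = degree G v ≡ 1

adj⇒≢ : ∀ {N} (G : Graph N) {v w} → Adj G v w → v ≢ w
adj⇒≢ G v~v refl = irrefl G v~v

K : ∀ n → Graph n
K n = record
  { Adj    = _≢_
  ; adj?   = λ i j → ¬? (i Fin.≟ j)
  ; symm   = λ i≢j j≡i → i≢j (sym j≡i)
  ; irrefl = λ i≢i → i≢i refl
  }

-- Deleting v renumbers the other vertices in order: vertex x of the
-- smaller graph is old v x, and w ≢ v becomes new v≢w.
old : ∀ {N} → Fin N → Fin (pred N) → Fin N
old {suc N} = punchIn

new : ∀ {N} {v w : Fin N} → v ≢ w → Fin (pred N)
new {suc N} = punchOut

infixl 8 _∖_

_∖_ : ∀ {N} → Graph N → Fin N → Graph (pred N)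
G ∖ v = record
  { Adj    = λ x y → Adj G (old v x) (old v y)
  ; adj?   = λ x y → adj? G (old v x) (old v y)
  ; symm   = symm G
  ; irrefl = irrefl G
  }

-- The vertices of the clan graph: inj₁ x is the vertex old v x of G, and
-- inj₂ i is vᵢ₊₁.
ClanAdj : ∀ {N} (G : Graph N) (v : Fin N) (n : ℕ) → Rel (Fin (pred N) ⊎ Fin n) 0ℓ
ClanAdj G v n (inj₁ x) (inj₁ y) = Adj G (old v x) (old v y)
ClanAdj G v n (inj₁ x) (inj₂ j) = Adj G (old v x) v
ClanAdj G v n (inj₂ i) (inj₁ y) = Adj G v (old v y)
ClanAdj G v n (inj₂ i) (inj₂ j) = i ≢ j

module _ {N} (G : Graph N) (v : Fin N) (n : ℕ) where

  clanAdj? : Decidable₂ (ClanAdj G v n)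
  clanAdj? (inj₁ x) (inj₁ y) = adj? G (old v x) (old v y)
  clanAdj? (inj₁ x) (inj₂ j) = adj? G (old v x) v
  clanAdj? (inj₂ i) (inj₁ y) = adj? G v (old v y)
  clanAdj? (inj₂ i) (inj₂ j) = ¬? (i Fin.≟ j)

  clanSymm : Symmetric (ClanAdj G v n)
  clanSymm {inj₁ _} {inj₁ _} = symm G
  clanSymm {inj₁ _} {inj₂ _} = symm G
  clanSymm {inj₂ _} {inj₁ _} = symm G
  clanSymm {inj₂ _} {inj₂ _} = λ i≢j j≡i → i≢j (sym j≡i)

  clanIrrefl : ∀ x → ¬ ClanAdj G v n x x
  clanIrrefl (inj₁ _) = irrefl G
  clanIrrefl (inj₂ _) = λ i≢i → i≢i refl

-- The first pred N vertices are those of G ∖ v, the last n are v₁, …, vₙ.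
clan : ∀ {N} → Graph N → Fin N → ∀ n → Graph (pred N ℕ.+ n)
clan {N} G v n = record
  { Adj    = λ x y → ClanAdj G v n (splitAt (pred N) x) (splitAt (pred N) y)
  ; adj?   = λ x y → clanAdj? G v n (splitAt (pred N) x) (splitAt (pred N) y)
  ; symm   = λ {x} {y} → clanSymm G v n {splitAt (pred N) x} {splitAt (pred N) y}
  ; irrefl = λ {x} → clanIrrefl G v n (splitAt (pred N) x)
  }

------------------------------------------------------------------------
-- Multicolorings

Multicoloring : ℕ → Set
Multicoloring N = Vec FinSet N

type : ∀ {N} → Multicoloring N → Vec ℕ N
type = Vec.map card

Proper : ∀ {N} → Graph N → Multicoloring N → Set
Proper G κ = ∀ w w′ → Adj G w w′ → Disjoint (lookup κ w) (lookup κ w′)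

proper? : ∀ {N} (G : Graph N) → Decidable (Proper G)
proper? G κ = Fin.all? λ w → Fin.all? λ w′ →
  adj? G w w′ →-dec disjoint? (lookup κ w) (lookup κ w′)

-- Every color in use is at a position below bound κ.
bound : ∀ {N} → Multicoloring N → ℕ
bound []      = 0
bound (S ∷ κ) = Sets.size S ⊔ bound κ

weight : ∀ {N} → Multicoloring N → Monomial
weight κ = Mono.fromList (List.applyUpTo (λ i → Vec.count (i ∈ˢ?_) κ) (bound κ))

boolLists : ℕ → List (List Bool)
boolLists zero    = [] ∷ []
boolLists (suc n) = [] ∷ List.cartesianProductWith _∷_ (false ∷ true ∷ []) (boolLists n)

∈-bools : ∀ b → b ∈ false ∷ true ∷ []
∈-bools false = here refl
∈-bools true  = there (here refl)

∈-boolLists : ∀ bs {n} → length bs ≤ n → bs ∈ boolLists n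
∈-boolLists []       {zero}  _         = here refl
∈-boolLists []       {suc n} _         = here refl
∈-boolLists (b ∷ bs) {suc n} (s≤s len) =
  there (∈-cartesianProductWith⁺ _∷_ (∈-bools b) (∈-boolLists bs len))

finSets : ℕ → List FinSet
finSets n = List.map Sets.fromList (boolLists n)

∈-finSets : ∀ S {n} → Sets.size S ≤ n → S ∈ finSets n
∈-finSets S {n} len = subst (_∈ finSets n) (Sets.fromList-entries S)
  (∈-map⁺ Sets.fromList (∈-boolLists (Sets.entries S) len))

vecs : {A : Set} → List A → ∀ N → List (Vec A N)
vecs L zero    = [] ∷ []
vecs L (suc N) = List.cartesianProductWith _∷_ L (vecs L N)

∈-vecs : ∀ {A : Set} (L : List A) {N} (κ : Vec A N) → (∀ w → lookup κ w ∈ L) → κ ∈ vecs L N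
∈-vecs L []      h = here refl
∈-vecs L (S ∷ κ) h = ∈-cartesianProductWith⁺ _∷_ (h zero) (∈-vecs L κ (h ∘ suc))

infix 4 _≟ᵏ_

_≟ᵏ_ : ∀ {N} → DecidableEquality (Multicoloring N)
_≟ᵏ_ = Vec.≡-dec Sets._≟ˢ_

size≤bound : ∀ {N} (κ : Multicoloring N) w → Sets.size (lookup κ w) ≤ bound κ
size≤bound (S ∷ κ) zero    = ℕ.m≤m⊔n _ _
size≤bound (S ∷ κ) (suc w) = ℕ.≤-trans (size≤bound κ w) (ℕ.m≤n⊔m (Sets.size S) _)

count≢0 : ∀ {N} (κ : Multicoloring N) w i → i ∈ˢ lookup κ w → Vec.count (i ∈ˢ?_) κ ≢ 0
count≢0 (S ∷ κ) zero i i∈S eq with S Sets.‼ i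
count≢0 (S ∷ κ) zero i i∈S () | true
count≢0 (S ∷ κ) (suc w) i i∈ eq with S Sets.‼ i
count≢0 (S ∷ κ) (suc w) i i∈ () | true
... | false = count≢0 κ w i i∈ eq

size≤weight : ∀ {N} (κ : Multicoloring N) w → Sets.size (lookup κ w) ≤ Mono.size (weight κ)
size≤weight κ w with Sets.size (lookup κ w) in eq
... | zero  = z≤n
... | suc k = Mono.at≢z⇒< (Mono.entries (weight κ)) λ e≡0 →
  count≢0 κ w k (≢false⇒T (Sets.last≢z (lookup κ w) eq))
    (trans (sym (trans (Mono.at-trim (List.applyUpTo _ (bound κ)) k)
                       (Mono.at-applyUpTo _ (subst (_≤ bound κ) eq (size≤bound κ w)))))
           e≡0)

indicator≢0 : ∀ {P : Set} (P? : Dec P) → (if does P? then 1ℤ else 0ℤ) ≢ 0ℤ → P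
indicator≢0 (yes p) _  = p
indicator≢0 (no _)  ≢0 = ⊥-elim (≢0 refl)

x^≢0 : ∀ a {m} → (x^ a) m ≢ 0ℤ → a ≡ m
x^≢0 a {m} = indicator≢0 (a Mono.≟ˢ m)

weight-summable : ∀ {N} → Summable {Multicoloring N} (λ κ → x^ weight κ)
weight-summable {N} = record
  { support  = λ m → List.deduplicate _≟ᵏ_ (candidates m)
  ; unique   = λ m → deduplicate-! _≟ᵏ_ (candidates m)
  ; complete = λ {m} {κ} ≢0 → ∈-deduplicate⁺ _≟ᵏ_
      (∈-vecs (finSets (Mono.size m)) κ λ w → ∈-finSets (lookup κ w)
        (subst (λ a → _ ≤ Mono.size a) (x^≢0 (weight κ) {m} ≢0) (size≤weight κ w)))
  }
  where
  candidates : Monomial → List (Multicoloring N)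
  candidates m = vecs (finSets (Mono.size m)) N

_≟ᵗ_ : ∀ {N} → DecidableEquality (Vec ℕ N)
_≟ᵗ_ = Vec.≡-dec ℕ._≟_

X : ∀ {N} → Graph N → Vec ℕ N → PowerSeries
X H α = ∑ (λ κ → x^ weight κ) weight-summable (λ κ → proper? H κ ×-dec (type κ ≟ᵗ α))

X-summable : ∀ {N} (H : Graph N) → Summable (X H)
X-summable {N} H = record
  { support  = λ m → List.deduplicate _≟ᵗ_ (List.map type (colorings m))
  ; unique   = λ m → deduplicate-! _≟ᵗ_ (List.map type (colorings m))
  ; complete = λ {m} {α} ≢0 → ∈-deduplicate⁺ _≟ᵗ_ (∈types m α ≢0)
  }
  where
  colorings : Monomial → List (Multicoloring N)
  colorings = Summable.support (weight-summable {N})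

  ∈types : ∀ m α → X H α m ≢ 0ℤ → α ∈ List.map type (colorings m)
  ∈types m α ≢0
    with List.filter (λ κ → proper? H κ ×-dec (type κ ≟ᵗ α)) (colorings m)
       | (λ {κ} → ∈-filter⁻ (λ κ → proper? H κ ×-dec (type κ ≟ᵗ α)) {κ} {colorings m})
  ... | []    | _  = ⊥-elim (≢0 refl)
  ... | κ ∷ _ | ∈⁻ with ∈⁻ (here refl)
  ...   | κ∈ , _ , refl = ∈-map⁺ type κ∈

Y : ∀ {N} → Graph N → PowerSeries
Y H = ∑ (X H) (X-summable H) U?

{-# OPTIONS --safe #-}

-- Both sides count proper multicolorings of the clan graph with weight m.
-- Those not using v₁, …, vₙ are the colorings of G ∖ v.  Those using some vᵢ
-- but not u split freely into a nonempty coloring of K n and a coloring of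
-- G ∖ v ∖ u, because u is the only vertex of G ∖ v adjacent to the vᵢ.  The
-- remaining ones are the last sum.  A product of power series is matched by
-- recording a coloring of each factor together with the two weights.
module Submission where

open import Data.Fin using (Fin; _↑ˡ_; _↑ʳ_)
open import Data.Fin.Properties using (any?)
open import Data.Nat using (ℕ; pred; _≤_; _≤?_)
open import Data.Vec using (lookup)
open import Relation.Nullary using (_×-dec_)
open import Defs

open import Level using (0ℓ)
open import Data.Bool.Base using (T; true; false; if_then_else_)
import Data.Bool.Properties as Bool
open import Data.Empty using (⊥-elim)
open import Data.Fin.Base using (zero; suc; punchIn; punchOut; splitAt; join)
open import Data.Fin.Properties as Fin
  using (splitAt-join; punchIn-punchOut)
open import Data.Integer.Base as ℤ using (ℤ; 0ℤ; 1ℤ; +_)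
import Data.Integer.Properties as ℤ
open import Data.Integer.Tactic.RingSolver using (solve-∀)
open import Data.List.Base as List
  using (List; []; _∷_; length; map; filter; applyUpTo; cartesianProduct; upTo)
open import Data.List.Membership.Propositional using (_∈_)
open import Data.List.Membership.Propositional.Properties
  using (∈-map⁺; ∈-map⁻; ∈-filter⁺; ∈-filter⁻; ∈-allFin; ∈-upTo⁺; ∈-upTo⁻; ∈-deduplicate⁺;
         ∈-cartesianProduct⁺; ∈-cartesianProduct⁻; ∈-cartesianProductWith⁺; ∈-cartesianProductWith⁻)
open import Data.List.Membership.Propositional.Properties.WithK using (unique∧set⇒bag)
open import Data.List.Properties using (length-map; length-applyUpTo; map-∘; map-cong)
open import Data.List.Relation.Binary.BagAndSetEquality using (∼bag⇒↭)
open import Data.List.Relation.Binary.Permutation.Propositional.Properties using (↭-length)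
open import Data.List.Relation.Unary.All as All using ([]; _∷_)
import Data.List.Relation.Unary.All.Properties as All
open import Data.List.Relation.Unary.AllPairs using ([]; _∷_)
open import Data.List.Relation.Unary.Any using (here; there)
open import Data.List.Relation.Unary.Unique.Propositional using (Unique)
import Data.List.Relation.Unary.Unique.Propositional.Properties as Unique
open import Data.Nat.Base as ℕ using (zero; suc; z≤n; s≤s)
import Data.Nat.Properties as ℕ
open import Data.Product using (_×_; _,_; proj₁; proj₂; ∃)
open import Data.Sum.Base using (_⊎_; inj₁; inj₂; [_,_]′)
open import Data.Unit.Base using (tt)
open import Data.Vec.Base as Vec using (Vec; []; _∷_)
import Data.Vec.Properties as Vec
open import Function.Bundles using (_⇔_; mk⇔; Equivalence)
open import Relation.Binary.Definitions using (DecidableEquality)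
open import Relation.Binary.PropositionalEquality hiding (J)
open import Relation.Nullary using (¬_; Dec; yes; no; does; ¬?)
open import Relation.Nullary.Decidable using (does-⇔; T?)
open import Relation.Unary using (Pred; Decidable; U)
open import Relation.Unary.Properties using (U?)

private variable
  I J : Set

-- Counting

-- The Iverson bracket. Its body agrees with that of `x^_`, so `(x^ weight κ) m` is
-- `⟦ weight κ Mono.≟ˢ m ⟧` by definition.
⟦_⟧ : {P : Set} → Dec P → ℤ
⟦ P? ⟧ = if does P? then 1ℤ else 0ℤ

⟦⟧-cong : {P Q : Set} → P ⇔ Q → (P? : Dec P) (Q? : Dec Q) → ⟦ P? ⟧ ≡ ⟦ Q? ⟧
⟦⟧-cong P⇔Q P? Q? = cong (if_then 1ℤ else 0ℤ) (does-⇔ P⇔Q P? Q?)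

⟦⟧-× : {P Q : Set} (P? : Dec P) (Q? : Dec Q) → ⟦ P? ⟧ ℤ.* ⟦ Q? ⟧ ≡ ⟦ P? ×-dec Q? ⟧
⟦⟧-× (yes _) Q? = ℤ.*-identityˡ ⟦ Q? ⟧
⟦⟧-× (no _)  Q? = ℤ.*-zeroˡ ⟦ Q? ⟧

⟦⟧-split : {P Q : Set} (P? : Dec P) (Q? : Dec Q) →
  ⟦ Q? ⟧ ≡ ⟦ P? ×-dec Q? ⟧ ℤ.+ ⟦ ¬? P? ×-dec Q? ⟧
⟦⟧-split (yes _) Q? = sym (ℤ.+-identityʳ ⟦ Q? ⟧)
⟦⟧-split (no _)  Q? = sym (ℤ.+-identityˡ ⟦ Q? ⟧)

∑ˡ : List I → (I → ℤ) → ℤ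
∑ˡ L f = sumℤ (map f L)

∑ˡ-cong-∈ : ∀ (L : List I) {f g} → (∀ {i} → i ∈ L → f i ≡ g i) → ∑ˡ L f ≡ ∑ˡ L g
∑ˡ-cong-∈ []      f≗g = refl
∑ˡ-cong-∈ (i ∷ L) f≗g = cong₂ ℤ._+_ (f≗g (here refl)) (∑ˡ-cong-∈ L λ i∈L → f≗g (there i∈L))

∑ˡ-cong : ∀ (L : List I) {f g} → (∀ i → f i ≡ g i) → ∑ˡ L f ≡ ∑ˡ L g
∑ˡ-cong L f≗g = ∑ˡ-cong-∈ L λ {i} _ → f≗g i

∑ˡ-+ : ∀ (L : List I) f g → ∑ˡ L (λ i → f i ℤ.+ g i) ≡ ∑ˡ L f ℤ.+ ∑ˡ L g
∑ˡ-+ []      f g = refl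
∑ˡ-+ (i ∷ L) f g = trans (cong (ℤ._+_ (f i ℤ.+ g i)) (∑ˡ-+ L f g))
  (interchange (f i) (g i) (∑ˡ L f) (∑ˡ L g))
  where
  interchange : ∀ a b c d → (a ℤ.+ b) ℤ.+ (c ℤ.+ d) ≡ (a ℤ.+ c) ℤ.+ (b ℤ.+ d)
  interchange = solve-∀

∑ˡ-*ˡ : ∀ (L : List I) c f → c ℤ.* ∑ˡ L f ≡ ∑ˡ L (λ i → c ℤ.* f i)
∑ˡ-*ˡ []      c f = ℤ.*-zeroʳ c
∑ˡ-*ˡ (i ∷ L) c f = trans (ℤ.*-distribˡ-+ c (f i) (∑ˡ L f)) (cong (ℤ._+_ (c ℤ.* f i)) (∑ˡ-*ˡ L c f))

∑ˡ-*ʳ : ∀ (L : List I) c f → ∑ˡ L f ℤ.* c ≡ ∑ˡ L (λ i → f i ℤ.* c)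
∑ˡ-*ʳ L c f = trans (ℤ.*-comm (∑ˡ L f) c)
  (trans (∑ˡ-*ˡ L c f) (∑ˡ-cong L λ i → ℤ.*-comm c (f i)))

-- Turns a restriction of the summation range into a factor, so that several conditions can be
-- merged with `⟦⟧-×`.
∑ˡ-filter : {P : Pred I 0ℓ} (P? : Decidable P) (L : List I) (f : I → ℤ) →
  ∑ˡ (filter P? L) f ≡ ∑ˡ L (λ i → ⟦ P? i ⟧ ℤ.* f i)
∑ˡ-filter P? []      f = refl
∑ˡ-filter P? (i ∷ L) f with does (P? i)
... | true  = cong₂ ℤ._+_ (sym (ℤ.*-identityˡ (f i))) (∑ˡ-filter P? L f)
... | false = trans (∑ˡ-filter P? L f)
  (sym (trans (cong (ℤ._+ ∑ˡ L (λ j → ⟦ P? j ⟧ ℤ.* f j)) (ℤ.*-zeroˡ (f i))) (ℤ.+-identityˡ _)))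

∑ˡ-++ : ∀ (L L′ : List I) f → ∑ˡ (L List.++ L′) f ≡ ∑ˡ L f ℤ.+ ∑ˡ L′ f
∑ˡ-++ []      L′ f = sym (ℤ.+-identityˡ _)
∑ˡ-++ (i ∷ L) L′ f = trans (cong (ℤ._+_ (f i)) (∑ˡ-++ L L′ f)) (sym (ℤ.+-assoc (f i) _ _))

∑ˡ-cartesianProduct : ∀ (L : List I) (L′ : List J) (f : I × J → ℤ) →
  ∑ˡ L (λ i → ∑ˡ L′ (λ j → f (i , j))) ≡ ∑ˡ (cartesianProduct L L′) f
∑ˡ-cartesianProduct []      L′ f = refl
∑ˡ-cartesianProduct (i ∷ L) L′ f = sym (trans
  (∑ˡ-++ (map (i ,_) L′) (cartesianProduct L L′) f)
  (cong₂ ℤ._+_ (cong sumℤ (sym (map-∘ L′))) (sym (∑ˡ-cartesianProduct L L′ f))))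

∑ˡ-*-∑ˡ : ∀ (L : List I) (L′ : List J) f g →
  ∑ˡ L f ℤ.* ∑ˡ L′ g ≡ ∑ˡ (cartesianProduct L L′) (λ (i , j) → f i ℤ.* g j)
∑ˡ-*-∑ˡ L L′ f g = trans (∑ˡ-*ʳ L (∑ˡ L′ g) f)
  (trans (∑ˡ-cong L λ i → ∑ˡ-*ˡ L′ (f i) g) (∑ˡ-cartesianProduct L L′ _))

# : {P : Pred I 0ℓ} → Decidable P → List I → ℤ
# P? L = ∑ˡ L (λ i → ⟦ P? i ⟧)

#-split : {P Q : Pred I 0ℓ} (P? : Decidable P) (Q? : Decidable Q) (L : List I) →
  # Q? L ≡ # (λ i → P? i ×-dec Q? i) L ℤ.+ # (λ i → ¬? (P? i) ×-dec Q? i) L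
#-split P? Q? L = trans (∑ˡ-cong L λ i → ⟦⟧-split (P? i) (Q? i)) (∑ˡ-+ L _ _)

#≡length : {P : Pred I 0ℓ} (P? : Decidable P) (L : List I) → # P? L ≡ + length (filter P? L)
#≡length P? []      = refl
#≡length P? (i ∷ L) with does (P? i)
... | true  = cong (ℤ._+_ 1ℤ) (#≡length P? L)
... | false = trans (ℤ.+-identityˡ _) (#≡length P? L)

map-unique : (f : I → J) {L : List I} →
  (∀ {i j} → i ∈ L → j ∈ L → f i ≡ f j → i ≡ j) → Unique L → Unique (map f L)
map-unique f inj [] = []
map-unique f inj (i∉L ∷ L!) =
  All.map⁺ (All.tabulate λ j∈L fi≡fj →
    All.lookup i∉L j∈L (inj (here refl) (there j∈L) fi≡fj))
  ∷ map-unique f (λ i∈ j∈ → inj (there i∈) (there j∈)) L!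

-- The filtered lists are free of duplicates, and after mapping by `φ` they have the same members,
-- so they are permutations of each other. Nothing is asked of `φ` and `ψ` outside the counted
-- elements; the lists may contain others.
#-bijection : {P : Pred I 0ℓ} {Q : Pred J 0ℓ} (P? : Decidable P) (Q? : Decidable Q)
  {L : List I} {L′ : List J} → Unique L → Unique L′ →
  (φ : I → J) (ψ : J → I) →
  (∀ {i} → i ∈ L → P i → φ i ∈ L′ × Q (φ i) × ψ (φ i) ≡ i) →
  (∀ {j} → j ∈ L′ → Q j → ψ j ∈ L × P (ψ j) × φ (ψ j) ≡ j) →
  # P? L ≡ # Q? L′
#-bijection P? Q? {L} {L′} L! L′! φ ψ P⇒Q Q⇒P = begin
  # P? L                           ≡⟨ #≡length P? L ⟩
  + length (filter P? L)           ≡⟨ cong +_ (length-map φ (filter P? L)) ⟨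
  + length (map φ (filter P? L))   ≡⟨ cong +_ (↭-length (∼bag⇒↭ (unique∧set⇒bag
      (map-unique φ φ-injective (Unique.filter⁺ P? L!)) (Unique.filter⁺ Q? L′!) (mk⇔ to from)))) ⟩
  + length (filter Q? L′)          ≡⟨ #≡length Q? L′ ⟨
  # Q? L′                          ∎
  where
  open ≡-Reasoning

  ψ∘φ : ∀ {i} → i ∈ filter P? L → ψ (φ i) ≡ i
  ψ∘φ i∈ with ∈-filter⁻ P? {xs = L} i∈
  ... | i∈L , p = proj₂ (proj₂ (P⇒Q i∈L p))

  φ-injective : ∀ {i j} → i ∈ filter P? L → j ∈ filter P? L → φ i ≡ φ j → i ≡ j
  φ-injective i∈ j∈ φi≡φj = trans (sym (ψ∘φ i∈)) (trans (cong ψ φi≡φj) (ψ∘φ j∈))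

  to : ∀ {j} → j ∈ map φ (filter P? L) → j ∈ filter Q? L′
  to j∈ with ∈-map⁻ φ j∈
  ... | i , i∈ , refl with ∈-filter⁻ P? {xs = L} i∈
  ...   | i∈L , p with P⇒Q i∈L p
  ...     | φi∈L′ , q , _ = ∈-filter⁺ Q? φi∈L′ q

  from : ∀ {j} → j ∈ filter Q? L′ → j ∈ map φ (filter P? L)
  from j∈ with ∈-filter⁻ Q? {xs = L′} j∈
  ... | j∈L′ , q with Q⇒P j∈L′ q
  ...   | ψj∈L , p , φψj≡j = subst (_∈ map φ (filter P? L)) φψj≡j (∈-map⁺ φ (∈-filter⁺ P? ψj∈L p))

#-cong : {P Q : Pred I 0ℓ} (P? : Decidable P) (Q? : Decidable Q) (L : List I) →
  (∀ i → P i ⇔ Q i) → # P? L ≡ # Q? L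
#-cong P? Q? L P⇔Q = ∑ˡ-cong L λ i → ⟦⟧-cong (P⇔Q i) (P? i) (Q? i)

-- Monomials

module _ {A : Set} {z : A} {_≟_ : DecidableEquality A} where

  open FinSupp z _≟_

  -- When one list is longer, its surplus entries all equal `z` and are trimmed away.
  trim-cong : ∀ xs ys → (∀ i → at xs i ≡ at ys i) → trim xs ≡ trim ys
  trim-cong []       []       h = refl
  trim-cong (x ∷ xs) (y ∷ ys) h = cong₂ _◂_ (h zero) (trim-cong xs ys λ i → h (suc i))
  trim-cong []       (y ∷ ys) h
    rewrite sym (trim-cong [] ys λ i → h (suc i)) with y ≟ z
  ... | yes _  = refl
  ... | no y≢z = ⊥-elim (y≢z (sym (h zero)))
  trim-cong (x ∷ xs) []       h
    rewrite trim-cong xs [] (λ i → h (suc i)) with x ≟ z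
  ... | yes _  = refl
  ... | no x≢z = ⊥-elim (x≢z (h zero))

  ‼-ext : ∀ {s t} → (∀ i → s ‼ i ≡ t ‼ i) → s ≡ t
  ‼-ext {s} {t} h = trans (sym (fromList-entries s))
    (trans (entries-injective (trim-cong (entries s) (entries t) h)) (fromList-entries t))

  at-length-injective : ∀ xs ys → length xs ≡ length ys → (∀ i → at xs i ≡ at ys i) → xs ≡ ys
  at-length-injective []       []       _   _ = refl
  at-length-injective (x ∷ xs) (y ∷ ys) len h = cong₂ _∷_ (h zero)
    (at-length-injective xs ys (ℕ.suc-injective len) λ i → h (suc i))

  -- Trimming loses only the number of trailing entries `z`, and the common length recovers it.
  fromList-injective : ∀ xs ys → length xs ≡ length ys → fromList xs ≡ fromList ys → xs ≡ ys
  fromList-injective xs ys len eq = at-length-injective xs ys len λ i →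
    trans (sym (at-trim xs i)) (trans (cong (_‼ i) eq) (at-trim ys i))

  at-≥ : ∀ xs {i} → length xs ≤ i → at xs i ≡ z
  at-≥ []       _         = refl
  at-≥ (x ∷ xs) (s≤s len) = at-≥ xs len

  fromList-applyUpTo-‼ : ∀ f n → (∀ i → n ≤ i → f i ≡ z) → ∀ i → fromList (applyUpTo f n) ‼ i ≡ f i
  fromList-applyUpTo-‼ f n f≡z i with ℕ.<-≤-connex i n
  ... | inj₁ i<n = trans (at-trim (applyUpTo f n) i) (at-applyUpTo f i<n)
  ... | inj₂ n≤i = trans (at-trim (applyUpTo f n) i) (trans
    (at-≥ (applyUpTo f n) (subst (_≤ i) (sym (length-applyUpTo f n)) n≤i)) (sym (f≡z i n≤i)))

-- Factorizations of a monomial, read off the exponents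

Factors : Monomial → Monomial × Monomial → Set
Factors m (a , b) = ∀ i → a Mono.‼ i ℕ.+ b Mono.‼ i ≡ m Mono.‼ i

splits-unique : ∀ es → Unique (splits es)
splits-unique []       = [] ∷ []
splits-unique (e ∷ es) = Unique.cartesianProductWith⁺ _ (λ { refl → refl , refl })
  (Unique.upTo⁺ (suc e)) (splits-unique es)

splits-length : ∀ es {as bs} → (as , bs) ∈ splits es → length as ≡ length es × length bs ≡ length es
splits-length []       (here refl) = refl , refl
splits-length (e ∷ es) p
  with ∈-cartesianProductWith⁻ _ (upTo (suc e)) (splits es) p
... | i , (as , bs) , _ , q , refl with splits-length es q
...   | len , len′ = cong suc len , cong suc len′

∈-splits : ∀ (f g : ℕ → ℕ) es → (∀ i → f i ℕ.+ g i ≡ Mono.at es i) →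
  (applyUpTo f (length es) , applyUpTo g (length es)) ∈ splits es
∈-splits f g []       h = here refl
∈-splits f g (e ∷ es) h = subst
  (λ e∸f → (applyUpTo f (suc (length es)) , e∸f ∷ applyUpTo (λ i → g (suc i)) (length es)) ∈ splits (e ∷ es))
  -- `splits` writes the second head as `e ∸ f 0`; since `e` is `f 0 + g 0`, this is `g 0`.
  (trans (cong (ℕ._∸ f 0) (sym (h 0))) (ℕ.m+n∸m≡n (f 0) (g 0)))
  (∈-cartesianProductWith⁺ _
    (∈-upTo⁺ (s≤s (subst (f 0 ≤_) (h 0) (ℕ.m≤m+n (f 0) (g 0)))))
    (∈-splits (λ i → f (suc i)) (λ i → g (suc i)) es (λ i → h (suc i))))

splits-sum : ∀ es {as bs} → (as , bs) ∈ splits es →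
  ∀ i → Mono.at as i ℕ.+ Mono.at bs i ≡ Mono.at es i
splits-sum []       (here refl) i = refl
splits-sum (e ∷ es) p i
  with ∈-cartesianProductWith⁻ _ (upTo (suc e)) (splits es) p
-- Membership in `upTo (suc e)` gives `j ≤ e`, so the truncated subtraction is exact.
splits-sum (e ∷ es) p zero    | j , _ , j∈ , _ , refl = ℕ.m+[n∸m]≡n (ℕ.≤-pred (∈-upTo⁻ j∈))
splits-sum (e ∷ es) p (suc i) | _ , _ , _ , q , refl = splits-sum es q i

-- All lists in a split have the length of the exponent list of `m`, so trimming them to monomials
-- identifies no two splits.
factorizations-unique : ∀ m → Unique (factorizations m)
factorizations-unique m = map-unique _ injective (splits-unique es)
  where
  es = Mono.entries m

  injective : ∀ {p q} → p ∈ splits es → q ∈ splits es →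
    (Mono.fromList (proj₁ p) , Mono.fromList (proj₂ p)) ≡
    (Mono.fromList (proj₁ q) , Mono.fromList (proj₂ q)) → p ≡ q
  injective {as , bs} {as′ , bs′} p∈ q∈ eq with splits-length es p∈ | splits-length es q∈
  ... | la , lb | la′ , lb′ = cong₂ _,_
    (fromList-injective as as′ (trans la (sym la′)) (cong proj₁ eq))
    (fromList-injective bs bs′ (trans lb (sym lb′)) (cong proj₂ eq))

-- Past the last exponent of `m` the exponents of `a` and `b` sum to zero, hence both vanish.
-- Tabulating them up to that point therefore loses nothing.
∈-factorizations⁺ : ∀ m {a b} → Factors m (a , b) → (a , b) ∈ factorizations m
∈-factorizations⁺ m {a} {b} h = subst (_∈ factorizations m)
  (cong₂ _,_
    (‼-ext (fromList-applyUpTo-‼ (a Mono.‼_) (length es)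
      λ i len → ℕ.m+n≡0⇒m≡0 (a Mono.‼ i) (trans (h i) (at-≥ {_≟_ = ℕ._≟_} es len))))
    (‼-ext (fromList-applyUpTo-‼ (b Mono.‼_) (length es)
      λ i len → ℕ.m+n≡0⇒n≡0 (a Mono.‼ i) (trans (h i) (at-≥ {_≟_ = ℕ._≟_} es len)))))
  (∈-map⁺ _ (∈-splits (a Mono.‼_) (b Mono.‼_) es h))
  where es = Mono.entries m

∈-factorizations⁻ : ∀ m {a b} → (a , b) ∈ factorizations m → Factors m (a , b)
∈-factorizations⁻ m ab∈ i with ∈-map⁻ _ ab∈
... | (as , bs) , p , refl =
  trans (cong₂ ℕ._+_ (Mono.at-trim as i) (Mono.at-trim bs i)) (splits-sum (Mono.entries m) p i)

-- Multicolorings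

∅ : FinSet
∅ = Sets.fromList []

disjoint-∅ˡ : ∀ {S} → Disjoint ∅ S
disjoint-∅ˡ i ()

disjoint-∅ʳ : ∀ {S} → Disjoint S ∅
disjoint-∅ʳ i ()

∈⇒1≤card : ∀ bs i → T (Sets.at bs i) → 1 ≤ length (filter T? bs)
∈⇒1≤card (true  ∷ bs) _       _ = s≤s z≤n
∈⇒1≤card (false ∷ bs) (suc i) t = ∈⇒1≤card bs i t

card≱1⇒≡∅ : ∀ {S} → ¬ 1 ≤ card S → S ≡ ∅
card≱1⇒≡∅ {S} ≱1 = ‼-ext λ i → helper i
  where
  helper : ∀ i → S Sets.‼ i ≡ false
  helper i with S Sets.‼ i in eq
  ... | false = refl
  ... | true  = ⊥-elim (≱1 (∈⇒1≤card (Sets.entries S) i (subst T (sym eq) _)))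

colors : ∀ {N} → Multicoloring N → ℕ → ℕ
colors κ i = Vec.count (i ∈ˢ?_) κ

colors-≥bound : ∀ {N} (κ : Multicoloring N) i → bound κ ≤ i → colors κ i ≡ 0
colors-≥bound []      i _ = refl
colors-≥bound (S ∷ κ) i b≤i
  rewrite at-≥ {z = false} {Bool._≟_} (Sets.entries S) {i} (ℕ.m⊔n≤o⇒m≤o _ (bound κ) b≤i)
  = colors-≥bound κ i (ℕ.m⊔n≤o⇒n≤o (Sets.size S) _ b≤i)

-- No color at or beyond `bound κ` occurs, so the cut-off in `weight` does no harm. Weights can now
-- be compared color by color.
weight-‼ : ∀ {N} (κ : Multicoloring N) i → weight κ Mono.‼ i ≡ colors κ i
weight-‼ κ = fromList-applyUpTo-‼ (colors κ) (bound κ) (colors-≥bound κ)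

colors-++ : ∀ {M N} (κ : Multicoloring M) (μ : Multicoloring N) i →
  colors (κ Vec.++ μ) i ≡ colors κ i ℕ.+ colors μ i
colors-++ []      μ i = refl
colors-++ (S ∷ κ) μ i with S Sets.‼ i
... | true  = cong suc (colors-++ κ μ i)
... | false = colors-++ κ μ i

colors-∅s : ∀ n i → colors (Vec.replicate n ∅) i ≡ 0
colors-∅s zero    i = refl
colors-∅s (suc n) i = colors-∅s n i

colors-insertAt-∅ : ∀ {N} (κ : Multicoloring N) x i → colors (Vec.insertAt κ x ∅) i ≡ colors κ i
colors-insertAt-∅ κ       zero    i = refl
colors-insertAt-∅ (S ∷ κ) (suc x) i with S Sets.‼ i
... | true  = cong suc (colors-insertAt-∅ κ x i)
... | false = colors-insertAt-∅ κ x i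

-- Divisibility of monomials and the finite lists of colorings

infix 4 _≼_

_≼_ : Monomial → Monomial → Set
a ≼ b = ∀ i → a Mono.‼ i ≤ b Mono.‼ i

-- The last stored exponent of `a` is nonzero, so `b` has a nonzero exponent there too.
≼⇒size≤ : ∀ {a b} → a ≼ b → Mono.size a ≤ Mono.size b
≼⇒size≤ {a} {b} a≼b with Mono.size a in eq
... | zero  = z≤n
... | suc k = Mono.at≢z⇒< (Mono.entries b) λ b≡0 →
  Mono.last≢z a eq (ℕ.n≤0⇒n≡0 (subst (a Mono.‼ k ≤_) b≡0 (a≼b k)))

colorings : ∀ N → Monomial → List (Multicoloring N)
colorings N = Summable.support (weight-summable {N})

colorings-unique : ∀ {N} m → Unique (colorings N m)
colorings-unique = Summable.unique weight-summable

-- The list for `m` is built from the size of `m` alone, so it also holds the colorings whose weight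
-- merely divides `m`. One list thus serves all factors of `m` at once.
∈-colorings : ∀ {N} {κ : Multicoloring N} m → weight κ ≼ m → κ ∈ colorings N m
∈-colorings {κ = κ} m w≼m = ∈-deduplicate⁺ _≟ᵏ_
  (∈-vecs (finSets (Mono.size m)) κ λ w → ∈-finSets (lookup κ w)
    (ℕ.≤-trans (size≤weight κ w) (≼⇒size≤ {weight κ} {m} w≼m)))

≡⇒∈-colorings : ∀ {N} {κ : Multicoloring N} m → weight κ ≡ m → κ ∈ colorings N m
≡⇒∈-colorings {κ = κ} m refl = ∈-colorings {κ = κ} m λ _ → ℕ.≤-refl

-- Coefficients as counts of proper colorings

module _ {N} (H : Graph N) (m : Monomial) {L : List (Multicoloring N)}
  (L! : Unique L) (∈-L : ∀ κ → weight κ ≡ m → κ ∈ L) where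

  -- A coloring determines its type, so the double sum over types and colorings of that type
  -- collapses to one over colorings. Any duplicate-free `L` containing the colorings of weight `m`
  -- will do, which allows `L` to be a list made for a multiple of `m`.
  ∑X-coefficient : {P : Pred (Vec ℕ N) 0ℓ} (P? : Decidable P) →
    ∑ (X H) (X-summable H) P? m ≡
    # (λ κ → P? (type κ) ×-dec proper? H κ ×-dec (weight κ Mono.≟ˢ m)) L
  ∑X-coefficient {P} P? = begin
    ∑ˡ (filter P? types) (λ α → X H α m)
      ≡⟨ ∑ˡ-filter P? types _ ⟩
    ∑ˡ types (λ α → ⟦ P? α ⟧ ℤ.* X H α m)
      ≡⟨ ∑ˡ-cong types coefficient ⟩
    ∑ˡ types (λ α → ∑ˡ C (λ κ → ⟦ Q? (α , κ) ⟧))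
      ≡⟨ ∑ˡ-cartesianProduct types C _ ⟩
    # Q? (cartesianProduct types C)
      ≡⟨ #-bijection Q? Good?
           (Unique.cartesianProduct⁺ (Summable.unique (X-summable H) m) (colorings-unique m)) L!
           proj₂ (λ κ → type κ , κ)
           (λ {(_ , κ)} _ → λ { (p , (pr , refl) , w) → ∈-L κ w , (p , pr , w) , refl })
           (λ {κ} _ (p , pr , w) →
             let κ∈C = ≡⇒∈-colorings {κ = κ} m w in
             ∈-cartesianProduct⁺ (∈-deduplicate⁺ _≟ᵗ_ (∈-map⁺ type κ∈C)) κ∈C , (p , (pr , refl) , w) , refl) ⟩
    # Good? L ∎
    where
    open ≡-Reasoning
    types = Summable.support (X-summable H) m
    C     = colorings N m

    Good? : Decidable (λ κ → P (type κ) × Proper H κ × weight κ ≡ m)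
    Good? κ = P? (type κ) ×-dec proper? H κ ×-dec (weight κ Mono.≟ˢ m)

    Q? : Decidable {A = Vec ℕ N × Multicoloring N}
      λ (α , κ) → P α × (Proper H κ × type κ ≡ α) × weight κ ≡ m
    Q? (α , κ) = P? α ×-dec (proper? H κ ×-dec (type κ ≟ᵗ α)) ×-dec (weight κ Mono.≟ˢ m)

    coefficient : ∀ α → ⟦ P? α ⟧ ℤ.* X H α m ≡ ∑ˡ C (λ κ → ⟦ Q? (α , κ) ⟧)
    coefficient α = begin
      ⟦ P? α ⟧ ℤ.* X H α m
        ≡⟨ cong (ℤ._*_ ⟦ P? α ⟧) (∑ˡ-filter R? C _) ⟩
      ⟦ P? α ⟧ ℤ.* ∑ˡ C (λ κ → ⟦ R? κ ⟧ ℤ.* ⟦ weight κ Mono.≟ˢ m ⟧)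
        ≡⟨ ∑ˡ-*ˡ C ⟦ P? α ⟧ _ ⟩
      ∑ˡ C (λ κ → ⟦ P? α ⟧ ℤ.* (⟦ R? κ ⟧ ℤ.* ⟦ weight κ Mono.≟ˢ m ⟧))
        ≡⟨ ∑ˡ-cong C (λ κ → trans (cong (ℤ._*_ ⟦ P? α ⟧) (⟦⟧-× (R? κ) (weight κ Mono.≟ˢ m)))
                                  (⟦⟧-× (P? α) (R? κ ×-dec (weight κ Mono.≟ˢ m)))) ⟩
      ∑ˡ C (λ κ → ⟦ Q? (α , κ) ⟧) ∎
      where
      R? : Decidable (λ κ → Proper H κ × type κ ≡ α)
      R? κ = proper? H κ ×-dec (type κ ≟ᵗ α)

  Y-coefficient : Y H m ≡ # (λ κ → proper? H κ ×-dec (weight κ Mono.≟ˢ m)) L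
  Y-coefficient = trans (∑X-coefficient {U} U?)
    (#-cong (λ κ → U? (type κ) ×-dec proper? H κ ×-dec (weight κ Mono.≟ˢ m)) (λ κ → proper? H κ ×-dec (weight κ Mono.≟ˢ m)) L λ κ → mk⇔ proj₂ (_ ,_))

≡∅s : ∀ {n} {μ : Multicoloring n} → (∀ j → lookup μ j ≡ ∅) → μ ≡ Vec.replicate n ∅
≡∅s {μ = []}    h = refl
≡∅s {μ = S ∷ μ} h = cong₂ _∷_ (h zero) (≡∅s λ j → h (suc j))

Used : ∀ {n} → Pred (Vec ℕ n) 0ℓ
Used α = ∃ λ j → 1 ≤ lookup α j

used? : ∀ {n} → Decidable (Used {n})
used? α = any? λ j → 1 ≤? lookup α j

lookup-type : ∀ {N} (κ : Multicoloring N) w → lookup (type κ) w ≡ card (lookup κ w)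
lookup-type κ w = Vec.lookup-map w card κ

¬Used⇒≡∅s : ∀ {n} {μ : Multicoloring n} → ¬ Used (type μ) → μ ≡ Vec.replicate n ∅
¬Used⇒≡∅s {μ = μ} ¬used = ≡∅s λ j → card≱1⇒≡∅ {lookup μ j} λ ≥1 →
  ¬used (j , subst (1 ≤_) (sym (lookup-type μ j)) ≥1)

¬Used-∅s : ∀ {n} → ¬ Used (type (Vec.replicate n ∅))
¬Used-∅s {suc n} (suc j , ≥1) = ¬Used-∅s {n} (j , ≥1)

weight-∅s : ∀ n → weight (Vec.replicate n ∅) ≡ Mono.fromList []
weight-∅s n = ‼-ext λ i → trans (weight-‼ (Vec.replicate n ∅) i) (colors-∅s n i)

proper-∅s : ∀ {n} (H : Graph n) → Proper H (Vec.replicate n ∅)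
proper-∅s {n} H w w′ _ rewrite Vec.lookup-replicate {n = n} w ∅ = disjoint-∅ˡ {lookup (Vec.replicate n ∅) w′}

-- Exactly one coloring uses no vertex, the all-empty one; it is proper of weight 1, and `𝟙` is its
-- contribution.
Y⊖𝟙-coefficient : ∀ {n} (H : Graph n) a {L : List (Multicoloring n)} →
  Unique L → (∀ κ → weight κ ≡ a → κ ∈ L) →
  (Y H ⊖ 𝟙) a ≡
  # (λ κ → used? (type κ) ×-dec proper? H κ ×-dec (weight κ Mono.≟ˢ a)) L
Y⊖𝟙-coefficient {n} H a {L} L! ∈-L = begin
  Y H a ℤ.- 𝟙 a                       ≡⟨ cong (ℤ._- 𝟙 a) (Y-coefficient H a L! ∈-L) ⟩
  # Good? L ℤ.- 𝟙 a                   ≡⟨ cong (ℤ._- 𝟙 a) (#-split Used? Good? L) ⟩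
  (count ℤ.+ # Empty? L) ℤ.- 𝟙 a      ≡⟨ cong (λ e → (count ℤ.+ e) ℤ.- 𝟙 a) empty ⟩
  (count ℤ.+ (𝟙 a ℤ.+ 0ℤ)) ℤ.- 𝟙 a    ≡⟨ cancel count (𝟙 a) ⟩
  count                               ∎
  where
  open ≡-Reasoning

  Used? : Decidable (λ κ → Used (type κ))
  Used? κ = used? (type κ)

  Good? : Decidable (λ κ → Proper H κ × weight κ ≡ a)
  Good? κ = proper? H κ ×-dec (weight κ Mono.≟ˢ a)

  Empty? : Decidable (λ κ → ¬ Used (type κ) × Proper H κ × weight κ ≡ a)
  Empty? κ = ¬? (Used? κ) ×-dec Good? κ

  count = # (λ κ → Used? κ ×-dec Good? κ) L

  cancel : ∀ c d → (c ℤ.+ (d ℤ.+ 0ℤ)) ℤ.- d ≡ c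
  cancel = solve-∀

  -- The one-element list stands for the all-empty coloring. Its count unfolds to `𝟙 a ℤ.+ 0ℤ`, the
  -- `0ℤ` being the end of the one-term sum.
  empty : # Empty? L ≡ # (λ _ → Mono.fromList [] Mono.≟ˢ a) (tt ∷ [])
  empty = #-bijection Empty? (λ _ → Mono.fromList [] Mono.≟ˢ a) L! ([] ∷ [])
    (λ _ → tt) (λ _ → Vec.replicate n ∅)
    (λ { {κ} _ (¬used , _ , w) → here refl
       , trans (sym (trans (cong weight (¬Used⇒≡∅s {μ = κ} ¬used)) (weight-∅s n))) w
       , sym (¬Used⇒≡∅s {μ = κ} ¬used) })
    (λ _ 𝟙≡a → let w = trans (weight-∅s n) 𝟙≡a in
      ∈-L _ w , (¬Used-∅s {n} , proper-∅s H , w) , refl)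

-- Color counts add under concatenation. The factors are swapped because the clique comes last among
-- the vertices but first in the product of power series.
weight-++ : ∀ {M N} (κ : Multicoloring M) (μ : Multicoloring N) {m} →
  weight (κ Vec.++ μ) ≡ m ⇔ Factors m (weight μ , weight κ)
weight-++ κ μ {m} = mk⇔
  (λ { refl i → sym (sum i) })
  (λ h → ‼-ext λ i → trans (sum i) (h i))
  where
  sum : ∀ i → weight (κ Vec.++ μ) Mono.‼ i ≡ weight μ Mono.‼ i ℕ.+ weight κ Mono.‼ i
  sum i = begin
    weight (κ Vec.++ μ) Mono.‼ i             ≡⟨ weight-‼ (κ Vec.++ μ) i ⟩
    colors (κ Vec.++ μ) i                    ≡⟨ colors-++ κ μ i ⟩
    colors κ i ℕ.+ colors μ i                ≡⟨ ℕ.+-comm (colors κ i) (colors μ i) ⟩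
    colors μ i ℕ.+ colors κ i                ≡⟨ cong₂ ℕ._+_ (weight-‼ μ i) (weight-‼ κ i) ⟨
    weight μ Mono.‼ i ℕ.+ weight κ Mono.‼ i  ∎
    where open ≡-Reasoning

weight-++-∅s : ∀ {N} (κ : Multicoloring N) n → weight (κ Vec.++ Vec.replicate n ∅) ≡ weight κ
weight-++-∅s κ n = Equivalence.from (weight-++ κ (Vec.replicate n ∅)) λ i →
  cong (ℕ._+ weight κ Mono.‼ i) (trans (weight-‼ (Vec.replicate n ∅) i) (colors-∅s n i))

weight-insertAt-∅ : ∀ {N} (κ : Multicoloring N) x → weight (Vec.insertAt κ x ∅) ≡ weight κ
weight-insertAt-∅ κ x = ‼-ext λ i →
  trans (weight-‼ (Vec.insertAt κ x ∅) i) (trans (colors-insertAt-∅ κ x i) (sym (weight-‼ κ i)))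

-- Colorings of the clan graph

punchIn-view : ∀ {N} (x w : Fin (suc N)) → w ≡ x ⊎ ∃ λ w′ → w ≡ punchIn x w′
punchIn-view x w with x Fin.≟ w
... | yes x≡w = inj₁ (sym x≡w)
... | no x≢w  = inj₂ (punchOut x≢w , sym (punchIn-punchOut x≢w))

-- The empty set is disjoint from everything, so edges at `x` impose no condition; the other edges
-- are those of `H ∖ x`.
proper-insertAt-∅ : ∀ {N} (H : Graph (suc N)) (κ : Multicoloring N) x →
  Proper H (Vec.insertAt κ x ∅) ⇔ Proper (H ∖ x) κ
proper-insertAt-∅ H κ x = mk⇔
  (λ proper w w′ w~w′ → subst₂ Disjoint (Vec.insertAt-punchIn κ x ∅ w) (Vec.insertAt-punchIn κ x ∅ w′)
    (proper (punchIn x w) (punchIn x w′) w~w′))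
  from
  where
  from : Proper (H ∖ x) κ → Proper H (Vec.insertAt κ x ∅)
  from proper w w′ w~w′ with punchIn-view x w | punchIn-view x w′
  ... | inj₁ refl | _ rewrite Vec.insertAt-lookup κ w ∅ = disjoint-∅ˡ {lookup (Vec.insertAt κ w ∅) w′}
  ... | inj₂ _ | inj₁ refl rewrite Vec.insertAt-lookup κ w′ ∅ = disjoint-∅ʳ {lookup (Vec.insertAt κ w′ ∅) w}
  ... | inj₂ (y , refl) | inj₂ (y′ , refl) =
    subst₂ Disjoint (sym (Vec.insertAt-punchIn κ x ∅ y)) (sym (Vec.insertAt-punchIn κ x ∅ y′))
      (proper y y′ w~w′)

module _ {N} (G : Graph N) (v : Fin N) (n : ℕ) (κ : Multicoloring (pred N)) (μ : Multicoloring n) where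

  private
    color : Fin (pred N) ⊎ Fin n → FinSet
    color = [ lookup κ , lookup μ ]′

    -- Properness over the sum type on which `ClanAdj` is defined, where the kinds of edges separate
    -- by pattern matching.
    Proper⊎ : Set
    Proper⊎ = ∀ s s′ → ClanAdj G v n s s′ → Disjoint (color s) (color s′)

    color-splitAt : ∀ w → lookup (κ Vec.++ μ) w ≡ color (splitAt (pred N) w)
    color-splitAt = Vec.lookup-splitAt (pred N) κ μ

    color-join : ∀ s → lookup (κ Vec.++ μ) (join (pred N) n s) ≡ color s
    color-join s = trans (color-splitAt (join (pred N) n s)) (cong color (splitAt-join (pred N) n s))

    to : Proper (clan G v n) (κ Vec.++ μ) → Proper⊎
    to proper s s′ s~s′ = subst₂ Disjoint (color-join s) (color-join s′)
      (proper (join (pred N) n s) (join (pred N) n s′)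
        (subst₂ (ClanAdj G v n) (sym (splitAt-join (pred N) n s)) (sym (splitAt-join (pred N) n s′)) s~s′))

  -- An edge lies inside `G ∖ v`, inside the clique, or between a neighbor of `v` and a clique
  -- vertex. Edges of the last kind are listed in one direction only; the other follows as adjacency
  -- and disjointness are symmetric.
  proper-++ : Proper (clan G v n) (κ Vec.++ μ) ⇔
    (Proper (G ∖ v) κ × Proper (K n) μ ×
     (∀ x j → Adj G v (old v x) → Disjoint (lookup κ x) (lookup μ j)))
  proper-++ = mk⇔
    (λ proper → (λ x y → to proper (inj₁ x) (inj₁ y)) , (λ i j → to proper (inj₂ i) (inj₂ j))
      , (λ x j v~x → to proper (inj₁ x) (inj₂ j) (symm G v~x)))
    λ (pκ , pμ , cross) w w′ w~w′ → subst₂ Disjoint (sym (color-splitAt w)) (sym (color-splitAt w′))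
      (from pκ pμ cross (splitAt (pred N) w) (splitAt (pred N) w′) w~w′)
    where
    from : Proper (G ∖ v) κ → Proper (K n) μ →
      (∀ x j → Adj G v (old v x) → Disjoint (lookup κ x) (lookup μ j)) → Proper⊎
    from pκ pμ cross (inj₁ x) (inj₁ y) = pκ x y
    from pκ pμ cross (inj₁ x) (inj₂ j) x~v = cross x j (symm G x~v)
    from pκ pμ cross (inj₂ i) (inj₁ y) v~y k (k∈i , k∈y) = cross y i v~y k (k∈y , k∈i)
    from pκ pμ cross (inj₂ i) (inj₂ j) = pμ i j

-- Both neighbors occur in the list whose length is the degree of `v`, namely 1.
leaf-neighbor-unique : ∀ {N} (G : Graph N) {v} → Leaf G v →
  ∀ {x y} → Adj G v x → Adj G v y → x ≡ y
leaf-neighbor-unique {N} G {v} leaf {x} {y} v~x v~y =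
  length-1 leaf (neighbor x v~x) (neighbor y v~y)
  where
  neighbor : ∀ w → Adj G v w → w ∈ filter (adj? G v) (List.allFin N)
  neighbor w v~w = ∈-filter⁺ (adj? G v) (∈-allFin w) v~w

  length-1 : ∀ {L : List (Fin N)} → length L ≡ 1 → x ∈ L → y ∈ L → x ≡ y
  length-1 {_ ∷ []} _ (here refl) (here refl) = refl

-- Links the condition on the last `n` vertices, as the theorem phrases it, to the clique part `μ`
-- alone.
used-++ : ∀ {M n} (κ : Multicoloring M) (μ : Multicoloring n) →
  (∃ λ j → 1 ≤ lookup (type (κ Vec.++ μ)) (M ↑ʳ j)) ⇔ Used (type μ)
used-++ {M} κ μ = mk⇔
  (λ (j , ≥1) → j , subst (1 ≤_) (same j) ≥1)
  (λ (j , ≥1) → j , subst (1 ≤_) (sym (same j)) ≥1)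
  where
  same : ∀ j → lookup (type (κ Vec.++ μ)) (M ↑ʳ j) ≡ lookup (type μ) j
  same j = trans (lookup-type (κ Vec.++ μ) (M ↑ʳ j))
    (trans (cong card (Vec.lookup-++ʳ κ μ j)) (sym (lookup-type μ j)))

-- The three classes of colorings of the clan graph, with `x` in the role of `u`

module LeafClan {M} (G : Graph (suc (suc M))) (v : Fin (suc (suc M))) (x : Fin (suc M))
  (only-x : ∀ y → Adj G v (punchIn v y) → y ≡ x) (n : ℕ) (m : Monomial) where

  private
    H = clan G v n
    L = colorings (suc M ℕ.+ n) m

    ClanUsed : Pred (Multicoloring (suc M ℕ.+ n)) 0ℓ
    ClanUsed χ = ∃ λ j → 1 ≤ lookup (type χ) (suc M ↑ʳ j)

    clanUsed? : Decidable ClanUsed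
    clanUsed? χ = any? λ j → 1 ≤? lookup (type χ) (suc M ↑ʳ j)

    uUsed? : Decidable (λ χ → 1 ≤ lookup (type χ) (x ↑ˡ n))
    uUsed? χ = 1 ≤? lookup (type χ) (x ↑ˡ n)

    Good : Pred (Multicoloring (suc M ℕ.+ n)) 0ℓ
    Good χ = Proper H χ × weight χ ≡ m

    good? : Decidable Good
    good? χ = proper? H χ ×-dec (weight χ Mono.≟ˢ m)

    split : ∀ {A : Set} (χ : Vec A (suc M ℕ.+ n)) →
      Vec.take (suc M) χ Vec.++ Vec.drop (suc M) χ ≡ χ
    split = Vec.take++drop≡id (suc M)

    take-++ : ∀ (κ : Multicoloring (suc M)) (μ : Multicoloring n) → Vec.take (suc M) (κ Vec.++ μ) ≡ κ
    take-++ κ μ = Vec.++-injectiveˡ (Vec.take (suc M) (κ Vec.++ μ)) κ (split (κ Vec.++ μ))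

    drop-++ : ∀ (κ : Multicoloring (suc M)) (μ : Multicoloring n) → Vec.drop (suc M) (κ Vec.++ μ) ≡ μ
    drop-++ κ μ = Vec.++-injectiveʳ (Vec.take (suc M) (κ Vec.++ μ)) κ (split (κ Vec.++ μ))

  clan-unused : # (λ χ → ¬? (clanUsed? χ) ×-dec good? χ) L ≡ Y (G ∖ v) m
  clan-unused = sym (trans
    (Y-coefficient (G ∖ v) m (colorings-unique m) (λ κ → ≡⇒∈-colorings {κ = κ} m))
    (#-bijection (λ κ → proper? (G ∖ v) κ ×-dec (weight κ Mono.≟ˢ m))
      (λ χ → ¬? (clanUsed? χ) ×-dec good? χ) (colorings-unique m) (colorings-unique m)
      (Vec._++ ∅s) (Vec.take (suc M))
      (λ {κ} _ (proper , w) → let w′ = trans (weight-++-∅s κ n) w in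
        ≡⇒∈-colorings {κ = κ Vec.++ ∅s} m w′
        , ((λ used → ¬Used-∅s {n} (Equivalence.to (used-++ κ ∅s) used))
          , Equivalence.from (proper-++ G v n κ ∅s)
              (proper , proper-∅s (K n) , λ y j _ → cross κ y j)
          , w′)
        , take-++ κ ∅s)
      (λ {χ} χ∈ → restrict χ (split χ))))
    where
    ∅s : Multicoloring n
    ∅s = Vec.replicate n ∅

    cross : ∀ (κ : Multicoloring (suc M)) y j → Disjoint (lookup κ y) (lookup ∅s j)
    cross κ y j rewrite Vec.lookup-replicate {n = n} j ∅ = disjoint-∅ʳ {lookup κ y}

    -- The splitting is passed as an equation so that matching on `refl` turns `χ` into a
    -- concatenation.
    restrict : ∀ χ {κ μ} → κ Vec.++ μ ≡ χ → ¬ ClanUsed χ × Good χ →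
      κ ∈ colorings (suc M) m × (Proper (G ∖ v) κ × weight κ ≡ m) × κ Vec.++ ∅s ≡ χ
    restrict _ {κ} {μ} refl (¬used , proper , w) with
      ¬Used⇒≡∅s {μ = μ} (λ used → ¬used (Equivalence.from (used-++ κ μ) used))
    ... | refl = ≡⇒∈-colorings {κ = κ} m w′ , (proj₁ (Equivalence.to (proper-++ G v n κ ∅s) proper) , w′) , refl
      where w′ = trans (sym (weight-++-∅s κ n)) w

  -- Once `u` carries the empty set, no condition ties the clique to the rest, so the two parts vary
  -- independently. The weights `(a , b)` are determined by the pair of colorings, which lets `cut`
  -- recover them.
  clan-used-u-unused :
    # (λ χ → ¬? (uUsed? χ) ×-dec clanUsed? χ ×-dec good? χ) L ≡ ((Y (K n) ⊖ 𝟙) ⊛ Y (G ∖ v ∖ x)) m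
  clan-used-u-unused = sym (begin
    ∑ˡ (factorizations m) (λ (a , b) → (Y (K n) ⊖ 𝟙) a ℤ.* Y (G ∖ v ∖ x) b)
      ≡⟨ ∑ˡ-cong-∈ (factorizations m) coefficient ⟩
    ∑ˡ (factorizations m) (λ ab → ∑ˡ pairs (λ μκ → ⟦ factored? (ab , μκ) ⟧))
      ≡⟨ ∑ˡ-cartesianProduct (factorizations m) pairs _ ⟩
    # factored? (cartesianProduct (factorizations m) pairs)
      ≡⟨ #-bijection factored? (λ χ → ¬? (uUsed? χ) ×-dec clanUsed? χ ×-dec good? χ)
           (Unique.cartesianProduct⁺ (factorizations-unique m)
             (Unique.cartesianProduct⁺ (colorings-unique m) (colorings-unique m)))
           (colorings-unique m) glue cut glue-factored (λ {χ} _ → cut-good χ) ⟩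
    # (λ χ → ¬? (uUsed? χ) ×-dec clanUsed? χ ×-dec good? χ) L ∎)
    where
    open ≡-Reasoning

    -- Both lists are taken at `m` rather than at the factors, so the inner range is the same for
    -- every factorization and the nested sums form a cartesian product.
    pairs : List (Multicoloring n × Multicoloring M)
    pairs = cartesianProduct (colorings n m) (colorings M m)

    Left : Monomial → Pred (Multicoloring n) 0ℓ
    Left a μ = Used (type μ) × Proper (K n) μ × weight μ ≡ a

    left? : ∀ a → Decidable (Left a)
    left? a μ = used? (type μ) ×-dec proper? (K n) μ ×-dec (weight μ Mono.≟ˢ a)

    Right : Monomial → Pred (Multicoloring M) 0ℓ
    Right b κ = Proper (G ∖ v ∖ x) κ × weight κ ≡ b

    right? : ∀ b → Decidable (Right b)
    right? b κ = proper? (G ∖ v ∖ x) κ ×-dec (weight κ Mono.≟ˢ b)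

    Factored : Pred ((Monomial × Monomial) × (Multicoloring n × Multicoloring M)) 0ℓ
    Factored ((a , b) , (μ , κ)) = Left a μ × Right b κ

    factored? : Decidable Factored
    factored? ((a , b) , (μ , κ)) = left? a μ ×-dec right? b κ

    module _ a b (h : Factors m (a , b)) where

      left-≼ : a ≼ m
      left-≼ i = subst (a Mono.‼ i ≤_) (h i) (ℕ.m≤m+n _ _)

      right-≼ : b ≼ m
      right-≼ i = subst (b Mono.‼ i ≤_) (h i) (ℕ.m≤n+m _ _)

    coefficient : ∀ {ab} → ab ∈ factorizations m →
      (Y (K n) ⊖ 𝟙) (proj₁ ab) ℤ.* Y (G ∖ v ∖ x) (proj₂ ab) ≡ ∑ˡ pairs (λ μκ → ⟦ factored? (ab , μκ) ⟧)
    coefficient {a , b} ab∈ = begin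
      (Y (K n) ⊖ 𝟙) a ℤ.* Y (G ∖ v ∖ x) b
        ≡⟨ cong₂ ℤ._*_
             (Y⊖𝟙-coefficient (K n) a (colorings-unique m)
               λ { μ refl → ∈-colorings {κ = μ} m (left-≼ a b h) })
             (Y-coefficient (G ∖ v ∖ x) b (colorings-unique m)
               λ { κ refl → ∈-colorings {κ = κ} m (right-≼ a b h) }) ⟩
      # (left? a) (colorings n m) ℤ.* # (right? b) (colorings M m)
        ≡⟨ ∑ˡ-*-∑ˡ (colorings n m) (colorings M m) _ _ ⟩
      ∑ˡ pairs (λ (μ , κ) → ⟦ left? a μ ⟧ ℤ.* ⟦ right? b κ ⟧)
        ≡⟨ ∑ˡ-cong pairs (λ (μ , κ) → ⟦⟧-× (left? a μ) (right? b κ)) ⟩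
      ∑ˡ pairs (λ μκ → ⟦ factored? ((a , b) , μκ) ⟧) ∎
      where
      h : Factors m (a , b)
      h = ∈-factorizations⁻ m ab∈

    glue : (Monomial × Monomial) × (Multicoloring n × Multicoloring M) → Multicoloring (suc M ℕ.+ n)
    glue (_ , (μ , κ)) = Vec.insertAt κ x ∅ Vec.++ μ

    cut : Multicoloring (suc M ℕ.+ n) → (Monomial × Monomial) × (Multicoloring n × Multicoloring M)
    cut χ = (weight μ , weight κ) , (μ , κ)
      where
      μ = Vec.drop (suc M) χ
      κ = Vec.removeAt (Vec.take (suc M) χ) x

    card-u : ∀ (κ : Multicoloring (suc M)) (μ : Multicoloring n) →
      lookup (type (κ Vec.++ μ)) (x ↑ˡ n) ≡ card (lookup κ x)
    card-u κ μ = trans (lookup-type (κ Vec.++ μ) (x ↑ˡ n)) (cong card (Vec.lookup-++ˡ κ μ x))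

    glue-factored : ∀ {t} → t ∈ cartesianProduct (factorizations m) pairs → Factored t →
      glue t ∈ L ×
      (¬ 1 ≤ lookup (type (glue t)) (x ↑ˡ n) × ClanUsed (glue t) × Good (glue t)) ×
      cut (glue t) ≡ t
    glue-factored {_ , (μ , κ)} t∈ ((used , pμ , refl) , (pκ , refl)) =
      ≡⇒∈-colorings {κ = κ∅ Vec.++ μ} m w
      , (¬u , Equivalence.from (used-++ κ∅ μ) used
        , Equivalence.from (proper-++ G v n κ∅ μ)
            (Equivalence.from (proper-insertAt-∅ (G ∖ v) κ x) pκ , pμ , cross)
        , w)
      , cong₂ (λ μ κ → (weight μ , weight κ) , (μ , κ)) (drop-++ κ∅ μ)
          (trans (cong (λ κ → Vec.removeAt κ x) (take-++ κ∅ μ)) (Vec.removeAt-insertAt κ x ∅))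
      where
      κ∅ = Vec.insertAt κ x ∅

      w : weight (κ∅ Vec.++ μ) ≡ m
      w = Equivalence.from (weight-++ κ∅ μ)
        (subst (λ b → Factors m (weight μ , b)) (sym (weight-insertAt-∅ κ x))
          (∈-factorizations⁻ m (proj₁ (∈-cartesianProduct⁻ (factorizations m) pairs t∈))))

      ¬u : ¬ 1 ≤ lookup (type (κ∅ Vec.++ μ)) (x ↑ˡ n)
      ¬u ≥1 with subst (1 ≤_) (trans (card-u κ∅ μ) (cong card (Vec.insertAt-lookup κ x ∅))) ≥1
      ... | ()

      -- A neighbor of `v` can only be `x`, and `κ∅` is empty there.
      cross : ∀ y j → Adj G v (punchIn v y) → Disjoint (lookup κ∅ y) (lookup μ j)
      cross y j v~y rewrite only-x y v~y | Vec.insertAt-lookup κ x ∅ = disjoint-∅ˡ {lookup μ j}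

    cut-good : ∀ χ → ¬ 1 ≤ lookup (type χ) (x ↑ˡ n) × ClanUsed χ × Good χ →
      cut χ ∈ cartesianProduct (factorizations m) pairs × Factored (cut χ) × glue (cut χ) ≡ χ
    cut-good χ (¬u , used , proper , w) =
      ∈-cartesianProduct⁺ (∈-factorizations⁺ m h)
        (∈-cartesianProduct⁺ (∈-colorings {κ = μ} m (left-≼ (weight μ) (weight κ) h))
                             (∈-colorings {κ = κ} m (right-≼ (weight μ) (weight κ) h)))
      , ((Equivalence.to (used-++ κ∅ μ) (subst ClanUsed (sym glued) used) , proj₁ (proj₂ properties) , refl)
        , (Equivalence.to (proper-insertAt-∅ (G ∖ v) κ x) (proj₁ properties) , refl))
      , glued
      where
      μ  = Vec.drop (suc M) χ
      κ⁺ = Vec.take (suc M) χ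
      κ  = Vec.removeAt κ⁺ x
      κ∅ = Vec.insertAt κ x ∅

      u≡∅ : lookup κ⁺ x ≡ ∅
      u≡∅ = card≱1⇒≡∅ λ ≥1 → ¬u (subst (1 ≤_)
        (sym (trans (cong (λ χ → lookup (type χ) (x ↑ˡ n)) (sym (split χ))) (card-u κ⁺ μ))) ≥1)

      -- The set removed at `x` was already empty, so inserting an empty set restores the coloring.
      glued : κ∅ Vec.++ μ ≡ χ
      glued = trans (cong (Vec._++ μ)
        (trans (cong (Vec.insertAt κ x) (sym u≡∅)) (Vec.insertAt-removeAt κ⁺ x))) (split χ)

      properties = Equivalence.to (proper-++ G v n κ∅ μ) (subst (Proper H) (sym glued) proper)

      h : Factors m (weight μ , weight κ)
      h = subst (λ b → Factors m (weight μ , b)) (weight-insertAt-∅ κ x)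
        (Equivalence.to (weight-++ κ∅ μ) (trans (cong weight glued) w))

  Y-clan : Y H m ≡
    (Y (G ∖ v) ⊕ (Y (K n) ⊖ 𝟙) ⊛ Y (G ∖ v ∖ x)
      ⊕ ∑ (X H) (X-summable H) (λ α →
          (1 ≤? lookup α (x ↑ˡ n)) ×-dec any? (λ j → 1 ≤? lookup α (suc M ↑ʳ j)))) m
  Y-clan = begin
    Y H m
      ≡⟨ Y-coefficient H m (colorings-unique m) (λ χ → ≡⇒∈-colorings {κ = χ} m) ⟩
    # good? L
      ≡⟨ #-split clanUsed? good? L ⟩
    # used-good? L ℤ.+ # (λ χ → ¬? (clanUsed? χ) ×-dec good? χ) L
      ≡⟨ cong₂ ℤ._+_ (#-split uUsed? used-good? L) clan-unused ⟩
    (# (λ χ → uUsed? χ ×-dec used-good? χ) L ℤ.+ # (λ χ → ¬? (uUsed? χ) ×-dec used-good? χ) L)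
      ℤ.+ Y (G ∖ v) m
      ≡⟨ cong (ℤ._+ Y (G ∖ v) m) (cong₂ ℤ._+_ both-used clan-used-u-unused) ⟩
    (∑XH ℤ.+ ((Y (K n) ⊖ 𝟙) ⊛ Y (G ∖ v ∖ x)) m) ℤ.+ Y (G ∖ v) m
      -- Each split puts the used case first, so the summands appear in the opposite of the stated
      -- order.
      ≡⟨ reverse ∑XH _ _ ⟩
    (Y (G ∖ v) m ℤ.+ ((Y (K n) ⊖ 𝟙) ⊛ Y (G ∖ v ∖ x)) m) ℤ.+ ∑XH ∎
    where
    open ≡-Reasoning

    P? : Decidable (λ α → 1 ≤ lookup α (x ↑ˡ n) × ∃ λ j → 1 ≤ lookup α (suc M ↑ʳ j))
    P? α = (1 ≤? lookup α (x ↑ˡ n)) ×-dec any? (λ j → 1 ≤? lookup α (suc M ↑ʳ j))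

    ∑XH = ∑ (X H) (X-summable H) P? m

    used-good? : Decidable (λ χ → ClanUsed χ × Good χ)
    used-good? χ = clanUsed? χ ×-dec good? χ

    both-used : # (λ χ → uUsed? χ ×-dec used-good? χ) L ≡ ∑XH
    both-used = trans
      (#-cong (λ χ → uUsed? χ ×-dec used-good? χ) (λ χ → P? (type χ) ×-dec good? χ) L
        λ χ → mk⇔ (λ (u , c , g) → (u , c) , g) (λ ((u , c) , g) → u , c , g))
      (sym (∑X-coefficient H m (colorings-unique m) (λ χ → ≡⇒∈-colorings {κ = χ} m) P?))

    reverse : ∀ a b c → (a ℤ.+ b) ℤ.+ c ≡ (c ℤ.+ b) ℤ.+ a
    reverse = solve-∀

proposition3p4 : ∀ {N} (G : Graph N) (u v : Fin N) → Leaf G v → (v~u : Adj G v u) →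
    ∀ n → 2 ≤ n →
    let u′ = new (adj⇒≢ G v~u) in
    Y (clan G v n) ≈
      Y (G ∖ v)
      ⊕ (Y (K n) ⊖ 𝟙) ⊛ Y (G ∖ v ∖ u′)
      ⊕ ∑ (X (clan G v n)) (X-summable (clan G v n)) (λ α →
          (1 ≤? lookup α (u′ ↑ˡ n)) ×-dec any? (λ i → 1 ≤? lookup α (pred N ↑ʳ i)))
-- With a single vertex the edge from `v` to `u` would be a loop.
proposition3p4 {suc zero}    G zero zero leaf v~u n 2≤n = ⊥-elim (irrefl G v~u)
-- Two vertices at least make `pred N` compute to `suc M`, the form in which `u` can be deleted from
-- `G ∖ v`.
proposition3p4 {suc (suc M)} G u    v    leaf v~u n 2≤n m =
  LeafClan.Y-clan G v (punchOut v≢u) only-u n m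
  where
  v≢u = adj⇒≢ G v~u

  -- The leaf condition, carried over to the numbering of `G ∖ v` by injectivity of `punchIn v`.
  only-u : ∀ y → Adj G v (punchIn v y) → y ≡ punchOut v≢u
  only-u y v~y = Fin.punchIn-injective v y (punchOut v≢u)
    (trans (leaf-neighbor-unique G leaf v~y v~u) (sym (punchIn-punchOut v≢u)))
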